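{- Let $\ell\ge1$ and let $V=v_\ell v_\ell\,v_{\ell-1}v_{\ell-1}\cdots v_2v_2\,v_1v_1=\prod_{j=\ell,\dots,2,1}(c_1x^jy^jc_2)^2$, where $v_j=c_1x^jy^jc_2$. The only accepting computation $\varepsilon\,\|\,V\vdash^*\varepsilon\,\|\,\varepsilon$ of the queue automaton is the one that, for each $k$, matches every symbol of one occurrence of $v_k$ in $V$ with the corresponding symbol of the other occurrence of $v_k$ in $V$.
   Context: Queue automaton: a configuration is written $Q\,\|\,x$ ($Q$ = queue contents, $x$ = remaining input); a step from $Q\,\|\,\sigma x$ ($\sigma$ a symbol) goes either to $Q\sigma\,\|\,x$ (push the input symbol) or, if $Q=\sigma Q'$, to $Q'\,\|\,x$ (the input symbol is matched against the leftmost queue symbol, which is popped; that queue symbol was pushed from an earlier input position and the two occurrences are said to be matched). $\vdash^*$ is zero or more steps; $\varepsilon$ is the empty string; an accepting computation of $w$ is a computation $\varepsilon\,\|\,w\vdash^*\varepsilon\,\|\,\varepsilon$. Here $c_1,c_2,x,y$ are four distinct symbols and $u^j$ denotes $j$ concatenated copies of $u$. -}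

module Defs where

open import Data.List.Base using (List; []; _∷_; _++_; [_]; _∷ʳ_; length; map; concat; concatMap; replicate; downFrom)
open import Data.List.Membership.Propositional using (_∈_)
open import Data.List.Relation.Unary.All using (All; []; _∷_)
open import Data.List.Relation.Unary.All.Properties using (∷ʳ⁺)
open import Data.Nat.Base using (ℕ; suc; _+_; _<_)
open import Data.Product.Base using (_×_; _,_; ∃₂)
open import Data.Sum.Base using (_⊎_)
open import Function.Bundles using (_⇔_)
open import Level using (Level)
open import Relation.Binary.Construct.Closure.ReflexiveTransitive using (Star; ε; _◅_)
open import Relation.Binary.PropositionalEquality using (_≡_)

private
  variable
    a : Level
    A : Set a

infix  4 _∥_
infix  3 _⊢_ _⊢*_
infixr 8 _^_

record Config (A : Set a) : Set a where
  constructor _∥_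
  field
    queue : List A
    input : List A

open Config public

data _⊢_ {A : Set a} : Config A → Config A → Set a where
  push : ∀ {Q σ w} → Q ∥ σ ∷ w ⊢ Q ∷ʳ σ ∥ w
  pop  : ∀ {Q σ w} → σ ∷ Q ∥ σ ∷ w ⊢ Q ∥ w

_⊢*_ : {A : Set a} → Config A → Config A → Set a
_⊢*_ = Star _⊢_

Accepting : {A : Set a} → List A → Set a
Accepting w = [] ∥ w ⊢* [] ∥ []

-- Every queue entry carries the input position it was pushed from, and n is the
-- position of the next input symbol. The result lists the pairs
-- (position pushed, position that popped it).
matchingFrom : {c d : Config A} → All (λ _ → ℕ) (queue c) → ℕ → c ⊢* d → List (ℕ × ℕ)
matchingFrom ps       n ε          = []
matchingFrom ps       n (push ◅ γ) = matchingFrom (∷ʳ⁺ ps n) (suc n) γ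
matchingFrom (p ∷ ps) n (pop  ◅ γ) = (p , n) ∷ matchingFrom ps (suc n) γ

-- Positions in w are counted from 0.
matching : {w : List A} → Accepting w → List (ℕ × ℕ)
matching = matchingFrom [] 0

OccursAt : {A : Set a} → List A → List A → ℕ → Set a
OccursAt u w o = ∃₂ λ p s → w ≡ p ++ u ++ s × length p ≡ o

-- u occurs in w exactly twice, at o₁ < o₂, and γ matches every symbol of the one
-- occurrence with the corresponding symbol of the other. A matched queue symbol
-- is always pushed before it is popped, so o₁ is on the left of each pair.
MatchesOccurrences : {A : Set a} {w : List A} → Accepting w → List A → Set a
MatchesOccurrences {w = w} γ u = ∃₂ λ o₁ o₂ →
  o₁ < o₂ ×
  (∀ o → OccursAt u w o ⇔ (o ≡ o₁ ⊎ o ≡ o₂)) ×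
  (∀ i → i < length u → (o₁ + i , o₂ + i) ∈ matching γ)

_^_ : {A : Set a} → List A → ℕ → List A
u ^ n = concat (replicate n u)

module _ {A : Set a} (c₁ c₂ x y : A) where

  v : ℕ → List A
  v j = [ c₁ ] ++ [ x ] ^ j ++ [ y ] ^ j ++ [ c₂ ]

  V : ℕ → List A
  V ℓ = concatMap (λ j → v j ^ 2) (map suc (downFrom ℓ))

{-# OPTIONS --safe #-}
-- Cut the input into blocks v_j. Call a factor c₁xⁿ or yⁿc₂ of the queue heavy
-- when n exceeds the sizes of the blocks to come: such a factor cannot be consumed
-- within one block. If a block starts on c₁xⁿ without finishing it, then that block
-- pushes all of its yʲc₂; if a block starts on yⁿc₂ without finishing it, then the
-- next block pushes all of its c₁xⁱ. So every heavy factor leaves a heavy successor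
-- behind. Two of them in the queue at a time are enough to cope with the delay
-- caused by consecutive blocks of equal size, and the queue never empties again.
-- Starting from the empty queue, any deviation from the intended computation within
-- v_j v_j leads to such a queue.
module Submission where

open import Defs
open import Data.Empty using (⊥-elim)
open import Data.List.Base using (List; []; _∷_; [_]; _++_; _∷ʳ_; length; concatMap; drop; replicate; iterate)
open import Data.List.Membership.Propositional using (_∈_)
open import Data.List.Properties
open import Data.List.Relation.Ternary.Interleaving.Propositional using (Interleaving; []; consˡ; consʳ)
open import Data.List.Relation.Unary.All as All using (All; []; _∷_)
open import Data.List.Relation.Unary.All.Properties using (∷ʳ⁺; drop⁺)
open import Data.List.Relation.Unary.AllPairs using ([]; _∷_)
open import Data.List.Relation.Unary.Any using (here; there)
open import Data.List.Relation.Unary.Unique.Propositional using (Unique)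
open import Data.Nat.Base using (ℕ; zero; suc; _+_; _≤_; _<_; z≤n; s≤s)
open import Data.Nat.Properties
open import Data.Product.Base using (Σ; ∃; ∃₂; _×_; _,_; proj₁; proj₂)
open import Data.Sum.Base using (_⊎_; inj₁; inj₂)
open import Function.Bundles using (_⇔_; mk⇔; Equivalence)
open import Level using (Level)
open import Relation.Binary.Construct.Closure.ReflexiveTransitive using (ε; _◅_)
open import Relation.Binary.PropositionalEquality using (_≡_; _≢_; refl; sym; ≢-sym; trans; cong; cong₂; subst; module ≡-Reasoning)
open import Relation.Nullary using (¬_; contradiction)

private
  variable
    a : Level
    A : Set a

-- Computations as lists of moves

data Move : Set where
  pushed popped : Move

trace : {c d : Config A} → c ⊢* d → List Move
trace ε          = []
trace (push ◅ γ) = pushed ∷ trace γ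
trace (pop  ◅ γ) = popped ∷ trace γ

-- A configuration and the kind of move fix the next configuration, so two computations can be
-- compared through their lists of moves.
trace-injective : {c d : Config A} (γ γ′ : c ⊢* d) → trace γ ≡ trace γ′ → γ ≡ γ′
trace-injective ε          ε           _  = refl
trace-injective (push ◅ γ) (push ◅ γ′) eq = cong (push ◅_) (trace-injective γ γ′ (∷-injectiveʳ eq))
trace-injective (pop  ◅ γ) (pop  ◅ γ′) eq = cong (pop ◅_) (trace-injective γ γ′ (∷-injectiveʳ eq))
trace-injective ε          (push ◅ _)  ()
trace-injective ε          (pop  ◅ _)  ()
trace-injective (push ◅ _) ε           ()
trace-injective (push ◅ _) (pop ◅ _)   ()
trace-injective (pop ◅ _)  ε           ()
trace-injective (pop ◅ _)  (push ◅ _)  ()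

-- A matching depends only on moves and positions; dropping the letters allows it to be evaluated on
-- an explicit list of moves. The clause for a pop from an empty list is a default, never reached by
-- a trace as long as `ps` lists the positions of its queue.
match : List ℕ → ℕ → List Move → List (ℕ × ℕ)
match ps       n []           = []
match ps       n (pushed ∷ t) = match (ps ∷ʳ n) (suc n) t
match []       n (popped ∷ t) = []
match (p ∷ ps) n (popped ∷ t) = (p , n) ∷ match ps (suc n) t

positions : {Q : List A} → All (λ _ → ℕ) Q → List ℕ
positions = All.reduce (λ p → p)

positions-∷ʳ⁺ : {Q : List A} {σ : A} (ps : All (λ _ → ℕ) Q) (n : ℕ) →
  positions (∷ʳ⁺ {x = σ} ps n) ≡ positions ps ∷ʳ n
positions-∷ʳ⁺ []       n = refl
positions-∷ʳ⁺ (p ∷ ps) n = cong (p ∷_) (positions-∷ʳ⁺ ps n)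

matchingFrom≡match : {c d : Config A} (ps : All (λ _ → ℕ) (queue c)) (n : ℕ) (γ : c ⊢* d) →
  matchingFrom ps n γ ≡ match (positions ps) n (trace γ)
matchingFrom≡match ps       n ε          = refl
matchingFrom≡match ps       n (push ◅ γ) =
  trans (matchingFrom≡match (∷ʳ⁺ ps n) (suc n) γ)
        (cong (λ qs → match qs (suc n) (trace γ)) (positions-∷ʳ⁺ ps n))
matchingFrom≡match (p ∷ ps) n (pop ◅ γ)  = cong ((p , n) ∷_) (matchingFrom≡match ps (suc n) γ)

match-pushes : ∀ qs n L t →
  match qs n (replicate L pushed ++ t) ≡ match (qs ++ iterate suc n L) (n + L) t
match-pushes qs n zero    t = cong₂ (λ ps m → match ps m t) (sym (++-identityʳ qs)) (sym (+-identityʳ n))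
match-pushes qs n (suc L) t =
  trans (match-pushes (qs ∷ʳ n) (suc n) L t)
        (cong₂ (λ ps m → match ps m t) (∷ʳ-++ qs n _) (sym (+-suc n L)))

match-pops-∈ : ∀ p n {L i} t → i < L → (p + i , n + i) ∈ match (iterate suc p L) n (replicate L popped ++ t)
match-pops-∈ p n {suc L} {zero}  t _         = here (cong₂ _,_ (+-identityʳ p) (+-identityʳ n))
match-pops-∈ p n {suc L} {suc i} t (s≤s i<L) =
  there (subst (_∈ match (iterate suc (suc p) L) (suc n) (replicate L popped ++ t))
               (cong₂ _,_ (sym (+-suc p i)) (sym (+-suc n i)))
               (match-pops-∈ (suc p) (suc n) t i<L))

match-pops-⊇ : ∀ p n L t {m} → m ∈ match [] (n + L) t → m ∈ match (iterate suc p L) n (replicate L popped ++ t)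
match-pops-⊇ p n zero    t {m} m∈ = subst (λ k → m ∈ match [] k t) (+-identityʳ n) m∈
match-pops-⊇ p n (suc L) t {m} m∈ =
  there (match-pops-⊇ (suc p) (suc n) L t (subst (λ k → m ∈ match [] k t) (+-suc n L) m∈))

square : ℕ → List Move
square L = replicate L pushed ++ replicate L popped

match-square : ∀ n L t → match [] n (square L ++ t) ≡ match (iterate suc n L) (n + L) (replicate L popped ++ t)
match-square n L t =
  trans (cong (match [] n) (++-assoc (replicate L pushed) (replicate L popped) t))
        (match-pushes [] n L (replicate L popped ++ t))

-- Construction of the intended computation

-- The moves are fixed in the type, so transport along an equation of words keeps them known.
Traced : List A → List A → List Move → Set _
Traced Q w t = Σ (Q ∥ w ⊢* [] ∥ []) λ γ → trace γ ≡ t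

push-word : ∀ (Q u : List A) {w t} → Traced (Q ++ u) w t → Traced Q (u ++ w) (replicate (length u) pushed ++ t)
push-word Q []      {w} {t} γ = subst (λ R → Traced R w t) (++-identityʳ Q) γ
push-word Q (σ ∷ u) {w} {t} γ
  with γ′ , eq ← push-word (Q ∷ʳ σ) u (subst (λ R → Traced R w t) (sym (∷ʳ-++ Q σ u)) γ)
  = push ◅ γ′ , cong (pushed ∷_) eq

pop-word : ∀ (u : List A) {w t} → Traced [] w t → Traced u (u ++ w) (replicate (length u) popped ++ t)
pop-word []      γ = γ
pop-word (σ ∷ u) γ with γ′ , eq ← pop-word u γ = pop ◅ γ′ , cong (popped ∷_) eq

square-word : ∀ (u : List A) {w t} → Traced [] w t → Traced [] (u ++ u ++ w) (square (length u) ++ t)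
square-word u {w} {t} γ =
  subst (Traced [] (u ++ u ++ w)) (sym (++-assoc (replicate (length u) pushed) _ t))
        (push-word [] u (pop-word u γ))

-- Reading a factor of the input

moves : {p ρ u : List A} → Interleaving p ρ u → List Move
moves []        = []
moves (consˡ sp) = popped ∷ moves sp
moves (consʳ sp) = pushed ∷ moves sp

moves-[]ˡ : {ρ u : List A} (sp : Interleaving [] ρ u) → moves sp ≡ replicate (length u) pushed
moves-[]ˡ []        = refl
moves-[]ˡ (consʳ sp) = cong (pushed ∷_) (moves-[]ˡ sp)

moves-[]ʳ : {p u : List A} (sp : Interleaving p [] u) → moves sp ≡ replicate (length u) popped
moves-[]ʳ []        = refl
moves-[]ʳ (consˡ sp) = cong (popped ∷_) (moves-[]ʳ sp)

-- Pushed letters go behind `Q` and popped ones come off the front, so `balance` holds in whatever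
-- order the moves occur. Later arguments solve this equation of words instead of following single
-- moves.
record Passage {A : Set a} (Q u w : List A) (t : List Move) : Set a where
  constructor passage
  field
    {popping pushing Q′} : List A
    split   : Interleaving popping pushing u
    balance : Q ++ pushing ≡ popping ++ Q′
    rest    : Q′ ∥ w ⊢* [] ∥ []
    traced  : t ≡ moves split ++ trace rest

pass : ∀ (Q u : List A) {w} (γ : Q ∥ u ++ w ⊢* [] ∥ []) → Passage Q u w (trace γ)
pass Q []      γ = passage [] (++-identityʳ Q) γ refl
pass Q (σ ∷ u) (push ◅ γ) with passage sp eq γ′ tr ← pass (Q ∷ʳ σ) u γ =
  passage (consʳ sp) (trans (sym (∷ʳ-++ Q σ _)) eq) γ′ (cong (pushed ∷_) tr)
pass (_ ∷ Q) (σ ∷ u) (pop ◅ γ) with passage sp eq γ′ tr ← pass Q u γ =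
  passage (consˡ sp) (cong (σ ∷_) eq) γ′ (cong (popped ∷_) tr)

-- Equations between words

-- Levi's lemma.
++-split : ∀ (as cs : List A) {bs ds} → as ++ bs ≡ cs ++ ds →
  (∃ λ e → as ≡ cs ++ e × ds ≡ e ++ bs) ⊎ (∃ λ e → cs ≡ as ++ e × bs ≡ e ++ ds)
++-split []       cs       eq = inj₂ (cs , refl , eq)
++-split (z ∷ as) []       eq = inj₁ (z ∷ as , refl , sym eq)
++-split (z ∷ as) (_ ∷ cs) eq with refl , eq′ ← ∷-injective eq with ++-split as cs eq′
... | inj₁ (e , refl , ds≡) = inj₁ (e , refl , ds≡)
... | inj₂ (e , refl , bs≡) = inj₂ (e , refl , bs≡)

^-head : ∀ {σ τ : A} → σ ≢ τ → ∀ n {s t} → [ σ ] ^ n ++ s ≡ τ ∷ t → n ≡ 0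
^-head σ≢τ zero    eq = refl
^-head σ≢τ (suc n) eq = contradiction (∷-injectiveˡ eq) σ≢τ

^-cancel : ∀ (σ : A) m n {s t} → [ σ ] ^ m ++ s ≡ [ σ ] ^ n ++ t →
  (∃ λ d → n ≡ m + d × s ≡ [ σ ] ^ d ++ t) ⊎ (∃ λ d → m ≡ n + suc d × [ σ ] ^ suc d ++ s ≡ t)
^-cancel σ zero    n       eq = inj₁ (n , refl , eq)
^-cancel σ (suc m) zero    eq = inj₂ (m , refl , eq)
^-cancel σ (suc m) (suc n) eq with ^-cancel σ m n (∷-injectiveʳ eq)
... | inj₁ (d , n≡ , s≡) = inj₁ (d , cong suc n≡ , s≡)
... | inj₂ (d , m≡ , t≡) = inj₂ (d , cong suc m≡ , t≡)

^-cancel-< : ∀ (σ : A) {m n s t} → m < n → [ σ ] ^ m ++ s ≡ [ σ ] ^ n ++ t → ∃ λ d → s ≡ [ σ ] ^ suc d ++ t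
^-cancel-< σ {m} {n} m<n eq with ^-cancel σ m n eq
... | inj₁ (zero  , refl , _)  = contradiction (subst (m <_) (+-identityʳ m) m<n) (<-irrefl refl)
... | inj₁ (suc d , _    , s≡) = d , s≡
... | inj₂ (d     , refl , _)  = contradiction (≤-<-trans (m≤m+n n (suc d)) m<n) (<-irrefl refl)

^-cancel-≢ : ∀ {σ τ : A} → σ ≢ τ → ∀ m n {s t} → [ σ ] ^ m ++ s ≡ [ σ ] ^ n ++ τ ∷ t →
  ∃ λ d → n ≡ m + d × s ≡ [ σ ] ^ d ++ τ ∷ t
^-cancel-≢ {σ = σ} σ≢τ m n eq with ^-cancel σ m n eq
... | inj₁ (d , n≡ , s≡) = d , n≡ , s≡
... | inj₂ (d , _  , eq′) = contradiction (∷-injectiveˡ eq′) σ≢τ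

-- Within a run of equal letters the popped and pushed parts are determined by their lengths alone.
split-^ : ∀ (σ : A) n {p ρ u} → Interleaving p ρ ([ σ ] ^ n ++ u) →
  ∃₂ λ m m′ → ∃₂ λ p′ ρ′ → m + m′ ≡ n × p ≡ [ σ ] ^ m ++ p′ × ρ ≡ [ σ ] ^ m′ ++ ρ′ × Interleaving p′ ρ′ u
split-^ σ zero    sp = 0 , 0 , _ , _ , refl , refl , refl , sp
split-^ σ (suc n) (consˡ sp) with m , m′ , _ , _ , refl , refl , refl , sp′ ← split-^ σ n sp =
  suc m , m′ , _ , _ , refl , refl , refl , sp′
split-^ σ (suc n) (consʳ sp) with m , m′ , _ , _ , refl , refl , refl , sp′ ← split-^ σ n sp =
  m , suc m′ , _ , _ , +-suc m m′ , refl , refl , sp′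

-- Block sizes and the intended moves

sizes : ℕ → List ℕ
sizes zero    = []
sizes (suc n) = suc n ∷ suc n ∷ sizes n

-- A size can repeat only in adjacent blocks, and the sizes after that are smaller.
data Thin : List ℕ → Set where
  []  : Thin []
  _∷_ : ∀ {j ns} → All (_< j) (drop 1 ns) → Thin ns → Thin (j ∷ ns)

sizes-< : ∀ n → All (_< suc n) (sizes n)
sizes-< zero    = []
sizes-< (suc n) = ≤-refl ∷ ≤-refl ∷ All.map m<n⇒m<1+n (sizes-< n)

sizes-thin : ∀ n → Thin (sizes n)
sizes-thin zero    = []
sizes-thin (suc n) = sizes-< n ∷ drop⁺ 1 (sizes-< n) ∷ sizes-thin n

canonical : (ℕ → ℕ) → ℕ → List Move
canonical size zero    = []
canonical size (suc n) = square (size (suc n)) ++ canonical size n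

module Blocks {a} {A : Set a} (c₁ c₂ x y : A)
  (c₁≢c₂ : c₁ ≢ c₂) (c₁≢x : c₁ ≢ x) (c₁≢y : c₁ ≢ y)
  (c₂≢x : c₂ ≢ x) (c₂≢y : c₂ ≢ y) (x≢y : x ≢ y) where

  -- Blocks and their popped and pushed parts

  block : ℕ → List A
  block = v c₁ c₂ x y

  blocks : List ℕ → List A
  blocks = concatMap block

  V≡blocks : ∀ n → V c₁ c₂ x y n ≡ blocks (sizes n)
  V≡blocks zero    = refl
  V≡blocks (suc n) = begin
    (b ++ (b ++ [])) ++ V c₁ c₂ x y n  ≡⟨ ++-assoc b (b ++ []) _ ⟩
    b ++ (b ++ []) ++ V c₁ c₂ x y n    ≡⟨ cong (λ u → b ++ u ++ V c₁ c₂ x y n) (++-identityʳ b) ⟩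
    b ++ b ++ V c₁ c₂ x y n            ≡⟨ cong (λ u → b ++ b ++ u) (V≡blocks n) ⟩
    b ++ b ++ blocks (sizes n)         ∎
    where
    open ≡-Reasoning
    b = block (suc n)

  -- `block j` is `word 1 j j 1 []` by computation. With exponents 0 or 1 for the single letters,
  -- one pattern describes both the popped and the pushed part.
  word : ℕ → ℕ → ℕ → ℕ → List A → List A
  word e m n f t = [ c₁ ] ^ e ++ [ x ] ^ m ++ [ y ] ^ n ++ [ c₂ ] ^ f ++ t

  word-++ : ∀ e m n f s {t} → word e m n f s ++ t ≡ word e m n f (s ++ t)
  word-++ e m n f s {t} =
    trans (++-assoc ([ c₁ ] ^ e) _ t) (cong ([ c₁ ] ^ e ++_) (
    trans (++-assoc ([ x ] ^ m) _ t) (cong ([ x ] ^ m ++_) (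
    trans (++-assoc ([ y ] ^ n) _ t) (cong ([ y ] ^ n ++_) (
    ++-assoc ([ c₂ ] ^ f) s t))))))

  data Cut (j : ℕ) : List A → List A → Set a where
    cut : ∀ {e e′ m m′ n n′ f f′} → e + e′ ≡ 1 → m + m′ ≡ j → n + n′ ≡ j → f + f′ ≡ 1 →
          Cut j (word e m n f []) (word e′ m′ n′ f′ [])

  cutting : ∀ j {p ρ} → Interleaving p ρ (block j) → Cut j p ρ
  cutting j sp
    with e , e′ , _ , _ , e+e′ , refl , refl , sp₁ ← split-^ c₁ 1 sp
    with m , m′ , _ , _ , m+m′ , refl , refl , sp₂ ← split-^ x j sp₁
    with n , n′ , _ , _ , n+n′ , refl , refl , sp₃ ← split-^ y j sp₂
    with f , f′ , _ , _ , f+f′ , refl , refl , []  ← split-^ c₂ 1 sp₃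
    = cut {e = e} {e′} {m} {m′} {n} {n′} {f} {f′} e+e′ m+m′ n+n′ f+f′

  -- Covers what a block can still pop once its `c₁` is behind. Such a word cannot enter `c₁xⁿ`, and
  -- the bound on its `y`s stops it inside `yⁿc₂` when `j < n`.
  data Tail (j : ℕ) : List A → Set a where
    tail : ∀ m n f → n ≤ j → Tail j (word 0 m n f [])

  Tail-∷⁻ : ∀ {j z s} → Tail j (z ∷ s) → Tail j s
  Tail-∷⁻ t = uncons t refl
    where
    uncons : ∀ {j z s l} → Tail j l → l ≡ z ∷ s → Tail j s
    uncons (tail (suc m) n       f       n≤j) refl = tail m n f n≤j
    uncons (tail zero    (suc n) f       n≤j) refl = tail 0 n f (<⇒≤ n≤j)
    uncons (tail zero    zero    (suc f) n≤j) refl = tail 0 0 f z≤n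

  Tail-++⁻ : ∀ {j} s {t} → Tail j (s ++ t) → Tail j t
  Tail-++⁻ []      t = t
  Tail-++⁻ (_ ∷ s) t = Tail-++⁻ s (Tail-∷⁻ t)

  Cut-∷⁻ : ∀ {j z p ρ} → Cut j (z ∷ p) ρ → Tail j p
  Cut-∷⁻ c = uncons c refl
    where
    uncons : ∀ {j z s p ρ} → Cut j p ρ → p ≡ z ∷ s → Tail j s
    uncons (cut {suc zero} {m = m} {n = n} {f = f} _ _ n+n′ _) refl = tail m n f (m+n≤o⇒m≤o n (≤-reflexive n+n′))
    uncons (cut {zero} {m = m} {n = n} {f = f} _ _ n+n′ _) eq =
      Tail-∷⁻ (subst (Tail _) eq (tail m n f (m+n≤o⇒m≤o n (≤-reflexive n+n′))))

  -- Heavy factors under one block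

  data Heavy (n : ℕ) : List A → Set a where
    c₁xⁿ : Heavy n (c₁ ∷ [ x ] ^ n)
    yⁿc₂ : Heavy n ([ y ] ^ n ++ [ c₂ ])

  -- The possible fates of a heavy `H`: not entered, left inside its `x`s, or left before its `c₂`.
  -- In `step`, `T` is everything behind `H`, the letters `ρ` pushed by the block included.
  data Eaten (H T ρ : List A) (j : ℕ) (Q : List A) : Set a where
    intact : ∀ α → Q ≡ α ++ H ++ T → Eaten H T ρ j Q
    in-x   : ∀ k ρ₀ → Q ≡ [ x ] ^ k ++ T → ρ ≡ ρ₀ ++ [ y ] ^ j ++ [ c₂ ] → Eaten H T ρ j Q
    in-y   : ∀ k → Q ≡ [ y ] ^ k ++ c₂ ∷ T → Eaten H T ρ j Q

  eat-tail : ∀ {j n H s T Q ρ} → Tail j s → Heavy n H → j < n → s ++ Q ≡ H ++ T → Eaten H T ρ j Q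
  eat-tail (tail m n f _) c₁xⁿ _ eq
    with eq ← trans (sym (word-++ 0 m n f [])) eq
    with refl ← ^-head (≢-sym c₁≢x) m eq
    with refl ← ^-head (≢-sym c₁≢y) n eq
    with refl ← ^-head (≢-sym c₁≢c₂) f eq
    = intact [] eq
  eat-tail {n = suc k} {T = T} (tail m n f n≤j) yⁿc₂ j<n eq
    with eq ← trans (sym (word-++ 0 m n f [])) (trans eq (++-assoc ([ y ] ^ suc k) [ c₂ ] T))
    with refl ← ^-head x≢y m eq
    -- At most `j` of the `y`s are popped, so one stays in front and bars the block's `c₂`.
    with d , eq ← ^-cancel-< y (≤-<-trans n≤j j<n) eq
    with refl ← ^-head c₂≢y f eq
    = in-y (suc d) eq

  eat-head : ∀ {j n H p ρ T Q} → Cut j p ρ → Heavy n H → j < n → p ++ Q ≡ H ++ T → Eaten H T ρ j Q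
  eat-head (cut {zero} {m = m} {n = n} {f = f} _ _ n+n′ _) h j<n eq =
    eat-tail (tail m n f (m+n≤o⇒m≤o n (≤-reflexive n+n′))) h j<n eq
  eat-head (cut {suc zero} {zero} {m} {m′} {n} {f = f} refl m+m′ n+n′ f+f′) c₁xⁿ j<n eq
    with eq ← trans (sym (word-++ 0 m n f [])) (∷-injectiveʳ eq)
    -- At most `j` of the `x`s are popped, so one stays in front and the whole of `yʲc₂` has to be
    -- pushed.
    with d , eq ← ^-cancel-< x (≤-<-trans (m+n≤o⇒m≤o m (≤-reflexive m+m′)) j<n) eq
    with refl ← ^-head (≢-sym x≢y) n eq
    with refl ← ^-head c₂≢x f eq
    with refl ← n+n′ | refl ← f+f′
    = in-x (suc d) ([ x ] ^ m′) eq refl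
  eat-head {n = suc k} (cut {suc zero} _ _ _ _) yⁿc₂ j<n eq = contradiction (∷-injectiveˡ eq) c₁≢y

  -- A block has its `c₁` in front. If `α` is nonempty, the first popped letter belongs to `α` and
  -- only a `Tail` can reach `H`.
  eat : ∀ α {j n H p ρ T Q} → Cut j p ρ → Heavy n H → j < n → p ++ Q ≡ α ++ H ++ T → Eaten H T ρ j Q
  eat []      c h j<n eq = eat-head c h j<n eq
  eat (z ∷ α) {p = []}    c h j<n eq = intact (z ∷ α) eq
  eat (z ∷ α) {p = _ ∷ p} c h j<n eq with ++-split p α (∷-injectiveʳ eq)
  ... | inj₂ (α′ , _ , eq′)   = intact α′ eq′
  ... | inj₁ (s , refl , eq′) = eat-tail (Tail-++⁻ α (Cut-∷⁻ c)) h j<n (sym eq′)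

  -- Queues that never empty

  -- Mostly used at `drop 1 ns`: a factor pushed by a block of size `j` has exponent `j`, and the
  -- next block may have size `j` too, so the factor is sure to be heavy only for the blocks after
  -- that one.
  data Contains (ns : List ℕ) : List A → Set a where
    contains : ∀ α {n H} β → Heavy n H → All (_< n) ns → Contains ns (α ++ H ++ β)

  contains-drop : ∀ {ns T} → Contains ns T → Contains (drop 1 ns) T
  contains-drop (contains α β h lt) = contains α β h (drop⁺ 1 lt)

  contains-++ʳ : ∀ {ns T} s → Contains ns T → Contains ns (T ++ s)
  contains-++ʳ s (contains α {H = H} β h lt) =
    subst (Contains _) (sym (trans (++-assoc α _ s) (cong (α ++_) (++-assoc H β s))))
          (contains α (β ++ s) h lt)

  -- The y or c₂ at the front in the last two cases forces the next block to push all
  -- of its c₁xʲ, which becomes the missing heavy factor.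
  data Doomed (ns : List ℕ) : List A → Set a where
    two  : ∀ α {n H T} → Heavy n H → All (_< n) ns → Contains (drop 1 ns) T → Doomed ns (α ++ H ++ T)
    led  : ∀ k {T} → Contains (drop 1 ns) T → Doomed ns ([ y ] ^ k ++ c₂ ∷ T)
    led₂ : ∀ k l T → Doomed ns ([ y ] ^ k ++ c₂ ∷ [ y ] ^ l ++ c₂ ∷ T)

  doomed⇒≢[] : ∀ {ns Q} → Doomed ns Q → Q ≢ []
  doomed⇒≢[] (two α {H = H} {T} h _ _) eq = heavy≢[] h (++-conicalˡ H T (++-conicalʳ α _ eq))
    where
    heavy≢[] : ∀ {n H} → Heavy n H → H ≢ []
    heavy≢[] {n} yⁿc₂ eq with () ← ++-conicalʳ ([ y ] ^ n) _ eq
  doomed⇒≢[] (led k _) eq with () ← ++-conicalʳ ([ y ] ^ k) _ eq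
  doomed⇒≢[] (led₂ k _ _) eq with () ← ++-conicalʳ ([ y ] ^ k) _ eq

  data Led (T : List A) (j : ℕ) (Q : List A) : Set a where
    stays : ∀ k s → Q ≡ [ y ] ^ k ++ c₂ ∷ T ++ c₁ ∷ [ x ] ^ j ++ s → Led T j Q
    gone  : ∀ s → Q ≡ T ++ c₁ ∷ [ x ] ^ j ++ s → Led T j Q

  ^-head-yᵏc₂ : ∀ {σ} → σ ≢ y → σ ≢ c₂ → ∀ m k {s t} → [ σ ] ^ m ++ s ≡ [ y ] ^ k ++ c₂ ∷ t → m ≡ 0
  ^-head-yᵏc₂ σ≢y σ≢c₂ m zero    eq = ^-head σ≢c₂ m eq
  ^-head-yᵏc₂ σ≢y σ≢c₂ m (suc k) eq = ^-head σ≢y m eq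

  -- The block's `c₁` and `x`s meet a `y` or `c₂` in front, so all are pushed. Whether its own `c₂`
  -- is popped decides between `gone` and `stays`.
  lead : ∀ {j p ρ Q} k T → Cut j p ρ → p ++ Q ≡ ([ y ] ^ k ++ c₂ ∷ T) ++ ρ → Led T j Q
  lead k T (cut {e} {e′} {m} {m′} {n} {n′} {f} {f′} e+e′ m+m′ n+n′ f+f′) eq
    with eq ← trans (sym (word-++ e m n f [])) (trans eq (++-assoc ([ y ] ^ k) (c₂ ∷ T) _))
    with refl ← ^-head-yᵏc₂ c₁≢y c₁≢c₂ e k eq
    with refl ← ^-head-yᵏc₂ x≢y (≢-sym c₂≢x) m k eq
    with refl ← e+e′ | refl ← m+m′ | f | f+f′ | ^-cancel-≢ (≢-sym c₂≢y) n k eq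
  ... | zero     | refl | d     , _ , eq₂ = stays d _ eq₂
  ... | suc zero | refl | zero  , _ , eq₂ = gone _ (∷-injectiveʳ eq₂)
  ... | suc zero | refl | suc d , _ , eq₂ = contradiction (∷-injectiveˡ eq₂) c₂≢y

  -- For a factor left inside its `x`s: the heavy factor in `T` moves up to first place, and the
  -- newly pushed `yʲc₂` becomes the second.
  two-++ : ∀ {ns T j} s ρ₀ → Contains ns T → All (_< j) (drop 1 ns) →
    Doomed ns (s ++ T ++ ρ₀ ++ [ y ] ^ j ++ [ c₂ ])
  two-++ {j = j} s ρ₀ (contains α {H = H} β h lt) j> =
    subst (Doomed _) regroup (two (s ++ α) h lt (contains (β ++ ρ₀) [] yⁿc₂ j>))
    where
    open ≡-Reasoning
    t = [ y ] ^ j ++ [ c₂ ]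
    regroup : (s ++ α) ++ H ++ (β ++ ρ₀) ++ t ++ [] ≡ s ++ (α ++ H ++ β) ++ ρ₀ ++ t
    regroup = begin
      (s ++ α) ++ H ++ (β ++ ρ₀) ++ t ++ []  ≡⟨ ++-assoc s α _ ⟩
      s ++ α ++ H ++ (β ++ ρ₀) ++ t ++ []    ≡⟨ cong (λ u → s ++ α ++ H ++ u) (++-assoc β ρ₀ _) ⟩
      s ++ α ++ H ++ β ++ ρ₀ ++ t ++ []      ≡⟨ cong (λ u → s ++ α ++ H ++ β ++ ρ₀ ++ u) (++-identityʳ t) ⟩
      s ++ α ++ H ++ β ++ ρ₀ ++ t            ≡⟨ cong (λ u → s ++ α ++ u) (++-assoc H β _) ⟨
      s ++ α ++ (H ++ β) ++ ρ₀ ++ t          ≡⟨ cong (s ++_) (++-assoc α (H ++ β) _) ⟨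
      s ++ (α ++ H ++ β) ++ ρ₀ ++ t          ∎

  step : ∀ {j ns Q p ρ Q′} → Thin (j ∷ ns) → Doomed (j ∷ ns) Q → Cut j p ρ → Q ++ ρ ≡ p ++ Q′ → Doomed ns Q′
  step (j> ∷ _) (two α {H = H} {T} h (j<n ∷ lt) t) c eq
    with eat α c h j<n (trans (sym eq) (trans (++-assoc α _ _) (cong (α ++_) (++-assoc H T _))))
  ... | intact α′ refl = two α′ h lt (contains-drop (contains-++ʳ _ t))
  ... | in-y k refl = led k (contains-drop (contains-++ʳ _ t))
  ... | in-x k ρ₀ refl refl = two-++ ([ x ] ^ k) ρ₀ t j>
  step (j> ∷ _) (led k (contains α {H = H} β h lt)) c eq with lead k _ c (sym eq)
  ... | stays d s refl = led d (contains-drop (contains-++ʳ _ (contains α β h lt)))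
  -- The factor in `T` becomes the first heavy one, the new `c₁xʲ` the second.
  ... | gone s refl =
    subst (Doomed _) (trans (cong (λ u → α ++ u) (sym (++-assoc H β _))) (sym (++-assoc α (H ++ β) _)))
          (two α h lt (contains β s c₁xⁿ j>))
  -- Either way the new `c₁xʲ` is the factor that `led` asks for; if `yᵏc₂` is gone, the second run
  -- of `y`s with its `c₂` takes its place.
  step (j> ∷ _) (led₂ k l T) c eq with lead k _ c (sym eq)
  ... | stays d s refl = led d (contains ([ y ] ^ l ++ c₂ ∷ T) s c₁xⁿ j>)
  ... | gone s refl =
    subst (Doomed _) (sym (++-assoc ([ y ] ^ l) (c₂ ∷ T) _)) (led l (contains T s c₁xⁿ j>))

  doomed : ∀ {ns Q} → Thin ns → Doomed ns Q → ¬ (Q ∥ blocks ns ⊢* [] ∥ [])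
  doomed {[]}     _              d ε = doomed⇒≢[] d refl
  doomed {j ∷ ns} th@(_ ∷ th′) d γ with passage sp eq γ′ _ ← pass _ (block j) γ =
    doomed th′ (step th d (cutting j sp) eq) γ′

  -- The two blocks read from an empty queue

  -- Popped letters must come from the same block. If `c₁` were popped, there would be no pushed
  -- `c₁` to match it; so `c₁` is pushed, stands in front and bars every later letter.
  first-block : ∀ {j p ρ Q} → Cut j p ρ → ρ ≡ p ++ Q → p ≡ [] × Q ≡ block j
  first-block (cut {zero} {m = m} {n = n} {f = f} refl m+m′ n+n′ f+f′) eq
    with eq₁ ← trans (sym (word-++ 0 m n f [])) (sym eq)
    with refl ← ^-head (≢-sym c₁≢x) m eq₁
    with refl ← ^-head (≢-sym c₁≢y) n eq₁
    with refl ← ^-head (≢-sym c₁≢c₂) f eq₁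
    with refl ← m+m′ | refl ← n+n′ | refl ← f+f′
    = refl , sym eq
  first-block (cut {suc zero} {m′ = m′} {n′ = n′} {f′ = f′} refl _ _ _) eq
    with refl ← ^-head (≢-sym c₁≢x) m′ eq
    with refl ← ^-head (≢-sym c₁≢y) n′ eq
    with refl ← ^-head (≢-sym c₁≢c₂) f′ eq
    with () ← eq

  -- Pushing `c₁` leaves two factors `c₁xʲ`; stopping inside the `x`s leaves two factors `yʲc₂`;
  -- popping all `x`s but pushing `c₂` leaves the queue of `led₂`. Otherwise the block is popped
  -- entirely.
  second-block : ∀ {j ns p ρ Q} → All (_< j) ns → Cut j p ρ → block j ++ ρ ≡ p ++ Q →
    (ρ ≡ [] × Q ≡ []) ⊎ Doomed ns Q
  second-block {j} lt (cut {zero} {m = m} {n = n} {f = f} refl m+m′ n+n′ f+f′) eq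
    with eq₁ ← trans (sym (word-++ 0 m n f [])) (sym eq)
    with refl ← ^-head (≢-sym c₁≢x) m eq₁
    with refl ← ^-head (≢-sym c₁≢y) n eq₁
    with refl ← ^-head (≢-sym c₁≢c₂) f eq₁
    with refl ← m+m′ | refl ← n+n′ | refl ← f+f′
    = inj₂ (subst (Doomed _) (trans (cong (c₁ ∷_) (sym (++-assoc ([ x ] ^ j) _ (block j)))) eq)
                  (two [] c₁xⁿ lt (contains ([ y ] ^ j ++ [ c₂ ]) _ c₁xⁿ (drop⁺ 1 lt))))
  second-block {j} {ρ = ρ} lt (cut {suc zero} {m = m} {m′} {n} {n′} {f} {f′} refl m+m′ n+n′ f+f′) eq
    with ^-cancel x m j (trans (sym (word-++ 0 m n f [])) (trans (∷-injectiveʳ (sym eq)) (++-assoc ([ x ] ^ j) _ ρ)))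
  ... | inj₂ (d , refl , _) =
    contradiction (≤-trans (m<m+n j {suc d} (s≤s z≤n)) (m+n≤o⇒m≤o _ (≤-reflexive m+m′))) (<-irrefl refl)
  ... | inj₁ (suc d , _ , eq₁)
    with refl ← ^-head (≢-sym x≢y) n eq₁
    with refl ← ^-head c₂≢x f eq₁
    with refl ← n+n′ | refl ← f+f′
    = inj₂ (subst (Doomed _) (sym eq₁) (two ([ x ] ^ suc d) yⁿc₂ lt
        (subst (Contains _) (cong ([ x ] ^ m′ ++_) (++-identityʳ _)) (contains ([ x ] ^ m′) [] yⁿc₂ (drop⁺ 1 lt)))))
  ... | inj₁ (zero , j≡ , eq₁)
    with refl ← +-cancelˡ-≡ m m′ 0 (trans m+m′ j≡)
    with f | f+f′ | ^-cancel-≢ (≢-sym c₂≢y) n j (trans eq₁ (++-assoc ([ y ] ^ j) [ c₂ ] _))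
  -- `d` may be 0: all `y`s popped and only `c₂` pushed.
  ... | zero     | refl | d     , _    , eq₂ = inj₂ (subst (Doomed _) (sym eq₂) (led₂ d n′ []))
  ... | suc zero | refl | suc d , _    , eq₂ = contradiction (∷-injectiveˡ eq₂) c₂≢y
  ... | suc zero | refl | zero  , j≡n  , eq₂
    with refl ← +-cancelˡ-≡ n n′ 0 (trans n+n′ j≡n)
    = inj₁ (refl , ∷-injectiveʳ eq₂)

  -- Uniqueness and existence of the computation

  size : ℕ → ℕ
  size j = length (block j)

  -- The equation on `w` lets a computation on `V` be treated without transporting it to `blocks`.
  trace-unique : ∀ n {w} → w ≡ blocks (sizes n) → (γ : Accepting w) → trace γ ≡ canonical size n
  trace-unique zero    refl ε = refl
  trace-unique (suc n) refl γ
    with passage sp₁ eq₁ γ₁ tr₁ ← pass [] (block (suc n)) γ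
    with refl , refl ← first-block (cutting (suc n) sp₁) eq₁
    with passage sp₂ eq₂ γ₂ tr₂ ← pass (block (suc n)) (block (suc n)) γ₁
    with second-block (sizes-< n) (cutting (suc n) sp₂) eq₂
  ... | inj₂ d = ⊥-elim (doomed (sizes-thin n) d γ₂)
  ... | inj₁ (refl , refl) = begin
    trace γ                                       ≡⟨ tr₁ ⟩
    moves sp₁ ++ trace γ₁                         ≡⟨ cong (moves sp₁ ++_) tr₂ ⟩
    moves sp₁ ++ moves sp₂ ++ trace γ₂            ≡⟨ ++-assoc (moves sp₁) (moves sp₂) _ ⟨
    (moves sp₁ ++ moves sp₂) ++ trace γ₂          ≡⟨ cong₂ _++_ (cong₂ _++_ (moves-[]ˡ sp₁) (moves-[]ʳ sp₂))
                                                            (trace-unique n refl γ₂) ⟩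
    canonical size (suc n)                        ∎
    where open ≡-Reasoning

  accepting : ∀ n → Traced [] (blocks (sizes n)) (canonical size n)
  accepting zero    = ε , refl
  accepting (suc n) = square-word (block (suc n)) (accepting n)

  -- Occurrences of a block

  occursAt-++ˡ : ∀ {u r : List A} {o} w → OccursAt u r o → OccursAt u (w ++ r) (length w + o)
  occursAt-++ˡ w (p , s , refl , refl) = w ++ p , s , sym (++-assoc w p _) , length-++ w

  Tail-c₁ : ∀ {j s} → ¬ Tail j (c₁ ∷ s)
  Tail-c₁ t = absurd t refl
    where
    absurd : ∀ {j l s} → Tail j l → l ≢ c₁ ∷ s
    absurd (tail m n f _) eq
      with refl ← ^-head (≢-sym c₁≢x) m eq
      with refl ← ^-head (≢-sym c₁≢y) n eq
      with refl ← ^-head (≢-sym c₁≢c₂) f eq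
      with () ← eq

  -- The run of `x`s after `c₁` ends at a `y` or `c₂`, so its length can be read off.
  block-injective : ∀ k j {s r} → block j ++ r ≡ block k ++ s → k ≡ j
  block-injective k j {s} {r} eq
    with ^-cancel x j k (trans (sym (++-assoc ([ x ] ^ j) _ r)) (trans (∷-injectiveʳ eq) (++-assoc ([ x ] ^ k) _ s)))
  ... | inj₁ (zero , k≡ , _)  = trans k≡ (+-identityʳ j)
  ... | inj₂ (d , _ , eq′)
    with () ← ^-head-yᵏc₂ x≢y (≢-sym c₂≢x) (suc d) k (trans eq′ (++-assoc ([ y ] ^ k) _ s))
  ... | inj₁ (suc d , _ , eq′)
    with () ← ^-head-yᵏc₂ x≢y (≢-sym c₂≢x) (suc d) j (trans (sym eq′) (++-assoc ([ y ] ^ j) _ r))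

  -- A block contains `c₁` only in front, so no occurrence of `block k` starts strictly inside
  -- `block j`.
  occursAt-block : ∀ k j {r o} → OccursAt (block k) (block j ++ r) o →
    (o ≡ 0 × k ≡ j) ⊎ (∃ λ o′ → o ≡ size j + o′ × OccursAt (block k) r o′)
  occursAt-block k j ([] , s , eq , refl) = inj₁ (refl , block-injective k j eq)
  occursAt-block k j (_ ∷ p , s , eq , refl)
    with refl , eq′ ← ∷-injective eq
    with ++-split ([ x ] ^ j ++ [ y ] ^ j ++ [ c₂ ]) p eq′
  ... | inj₂ (e , refl , refl) =
    inj₂ (length e , cong suc (length-++ ([ x ] ^ j ++ [ y ] ^ j ++ [ c₂ ])) , e , s , refl , refl)
  ... | inj₁ ([] , p≡ , r≡) =
    inj₂ (0 , trans (cong suc (cong length (trans (sym (++-identityʳ p)) (sym p≡)))) (sym (+-identityʳ _)) ,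
          [] , s , sym r≡ , refl)
  -- This start would put a `c₁` among the later letters of the block, which form a `Tail`.
  ... | inj₁ (z ∷ e , p≡ , r≡) with refl ← ∷-injectiveˡ r≡ =
    ⊥-elim (Tail-c₁ (Tail-++⁻ p (subst (Tail j) p≡ (tail j j 1 ≤-refl))))

  occursAt-≤ : ∀ k n {o} → OccursAt (block k) (blocks (sizes n)) o → k ≤ n
  occursAt-≤ k zero    ([]    , _ , () , _)
  occursAt-≤ k zero    (_ ∷ _ , _ , () , _)
  occursAt-≤ k (suc n) occ with occursAt-block k (suc n) occ
  ... | inj₁ (_ , refl) = ≤-refl
  ... | inj₂ (_ , _ , occ₁) with occursAt-block k (suc n) occ₁
  ...   | inj₁ (_ , refl) = ≤-refl
  ...   | inj₂ (_ , _ , occ₂) = m≤n⇒m≤1+n (occursAt-≤ k n occ₂)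

  -- Matching of the two occurrences

  -- `m` is the position where reading begins; it is arbitrary because the induction puts larger
  -- blocks in front.
  Paired : ℕ → ℕ → ℕ → Set a
  Paired k n o =
    (∀ o′ → OccursAt (block k) (blocks (sizes n)) o′ ⇔ (o′ ≡ o ⊎ o′ ≡ o + size k)) ×
    (∀ m i → i < size k → (m + o + i , m + (o + size k) + i) ∈ match [] m (canonical size n))

  paired-first : ∀ n → Paired (suc n) (suc n) 0
  paired-first n = (λ o → mk⇔ to from) , matched
    where
    k = suc n
    L = size k
    to : ∀ {o} → OccursAt (block k) (blocks (sizes k)) o → o ≡ 0 ⊎ o ≡ L
    to occ with occursAt-block k k occ
    ... | inj₁ (o≡0 , _) = inj₁ o≡0
    ... | inj₂ (_ , refl , occ₁) with occursAt-block k k occ₁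
    ...   | inj₁ (refl , _) = inj₂ (+-identityʳ L)
    -- A third occurrence would lie among blocks of size at most `n`.
    ...   | inj₂ (_ , _ , occ₂) = contradiction (occursAt-≤ k n occ₂) (<-irrefl refl)
    from : ∀ {o} → o ≡ 0 ⊎ o ≡ L → OccursAt (block k) (blocks (sizes k)) o
    from (inj₁ refl) = [] , _ , refl , refl
    from (inj₂ refl) = block k , _ , refl , refl
    matched : ∀ m i → i < L → (m + 0 + i , m + L + i) ∈ match [] m (canonical size k)
    matched m i i<L rewrite +-identityʳ m | match-square m L (canonical size n) =
      match-pops-∈ m (m + L) (canonical size n) i<L

  -- The two larger blocks in front contain no start of `block k` and leave the queue empty, so
  -- everything is shifted by twice their length.
  paired-later : ∀ {k n o} → k ≤ n → Paired k n o → Paired k (suc n) (size (suc n) + (size (suc n) + o))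
  paired-later {k} {n} {o} k≤n (occurs , matches) = (λ o′ → mk⇔ to from) , matched
    where
    L = size (suc n)
    regroup : ∀ l → (L + (L + o)) + l ≡ L + (L + (o + l))
    regroup l = trans (+-assoc L (L + o) l) (cong (L +_) (+-assoc L o l))
    shift : ∀ m l → m + L + L + l ≡ m + (L + (L + l))
    shift m l = trans (+-assoc (m + L) L l) (+-assoc m L (L + l))
    to : ∀ {o′} → OccursAt (block k) (blocks (sizes (suc n))) o′ → o′ ≡ L + (L + o) ⊎ o′ ≡ L + (L + o) + size k
    to occ with occursAt-block k (suc n) occ
    ... | inj₁ (_ , refl) = contradiction k≤n (<-irrefl refl)
    ... | inj₂ (_ , refl , occ₁) with occursAt-block k (suc n) occ₁
    ...   | inj₁ (_ , refl) = contradiction k≤n (<-irrefl refl)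
    ...   | inj₂ (_ , refl , occ₂) with Equivalence.to (occurs _) occ₂
    ...     | inj₁ refl = inj₁ refl
    ...     | inj₂ refl = inj₂ (sym (regroup (size k)))
    lift : ∀ {o′} → OccursAt (block k) (blocks (sizes n)) o′ → OccursAt (block k) (blocks (sizes (suc n))) (L + (L + o′))
    lift occ = occursAt-++ˡ (block (suc n)) (occursAt-++ˡ (block (suc n)) occ)
    from : ∀ {o′} → o′ ≡ L + (L + o) ⊎ o′ ≡ L + (L + o) + size k → OccursAt (block k) (blocks (sizes (suc n))) o′
    from (inj₁ refl) = lift (Equivalence.from (occurs _) (inj₁ refl))
    from (inj₂ refl) = subst (OccursAt _ _) (sym (regroup (size k))) (lift (Equivalence.from (occurs _) (inj₂ refl)))
    matched : ∀ m i → i < size k →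
      (m + (L + (L + o)) + i , m + (L + (L + o) + size k) + i) ∈ match [] m (canonical size (suc n))
    matched m i i<
      rewrite regroup (size k) | sym (shift m o) | sym (shift m (o + size k)) | match-square m L (canonical size n) =
      match-pops-⊇ m (m + L) L (canonical size n) (matches (m + L + L) i i<)

  paired : ∀ n {k} → 1 ≤ k → k ≤ n → ∃ (Paired k n)
  paired zero    1≤k k≤0 = contradiction (≤-trans 1≤k k≤0) λ ()
  paired (suc n) 1≤k k≤  with m≤n⇒m<n∨m≡n k≤
  ... | inj₂ refl      = 0 , paired-first n
  ... | inj₁ (s≤s k≤n) with o , h ← paired n 1≤k k≤n = _ , paired-later k≤n h

  matches-occurrences : ∀ n {k} → 1 ≤ k → k ≤ n → {w : List A} → w ≡ blocks (sizes n) →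
    (γ : Accepting w) → trace γ ≡ canonical size n → MatchesOccurrences γ (block k)
  matches-occurrences n {k} 1≤k k≤n refl γ tr with o , occurs , matches ← paired n 1≤k k≤n =
    o , o + size k , m<m+n o (s≤s z≤n) , occurs , λ i i< →
      subst ((o + i , o + size k + i) ∈_)
            (sym (trans (matchingFrom≡match [] 0 γ) (cong (match [] 0) tr)))
            (matches 0 i i<)

theorem3 : ∀ {a} {A : Set a} (c₁ c₂ x y : A) → Unique (c₁ ∷ c₂ ∷ x ∷ y ∷ []) →
    ∀ (ℓ : ℕ) → 1 ≤ ℓ →
    Σ (Accepting (V c₁ c₂ x y ℓ)) λ γ →
    (∀ k → 1 ≤ k → k ≤ ℓ → MatchesOccurrences γ (v c₁ c₂ x y k)) ×
    (∀ (γ′ : Accepting (V c₁ c₂ x y ℓ)) → γ′ ≡ γ)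
theorem3 c₁ c₂ x y
  ((c₁≢c₂ ∷ c₁≢x ∷ c₁≢y ∷ []) ∷ (c₂≢x ∷ c₂≢y ∷ []) ∷ (x≢y ∷ []) ∷ [] ∷ []) ℓ _ =
  γ , (λ k 1≤k k≤ℓ → matches-occurrences ℓ 1≤k k≤ℓ (V≡blocks ℓ) γ tr) ,
      λ γ′ → trace-injective γ′ γ (trans (trace-unique ℓ (V≡blocks ℓ) γ′) (sym tr))
  where
  open Blocks c₁ c₂ x y c₁≢c₂ c₁≢x c₁≢y c₂≢x c₂≢y x≢y
  traced : Traced [] (V c₁ c₂ x y ℓ) (canonical size ℓ)
  traced = subst (λ w → Traced [] w (canonical size ℓ)) (sym (V≡blocks ℓ)) (accepting ℓ)
  γ = proj₁ traced
  tr = proj₂ traced
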